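{- The reverse translation property of Kuroda's translation does not hold in general in higher-order logic: there are a choice of the set of constants, a context $\Gamma$ and a formula $A$ such that $\Gamma_{Ku}\vdash_i A^{Ku}$ holds but $\Gamma\vdash_c A$ does not hold.
   Context: Syntax. Simple types are generated by: $\iota$ (individuals), $o$ (propositions), and $\tau \to \sigma$ for types $\tau,\sigma$. For each type $\tau$ there are a set $\mathcal{V}_\tau$ of variables (infinitely many, as usual) and a set $\mathcal{C}_\tau$ of constants; variables and constants are disjoint. Terms are simply typed: variables and constants of type $\tau$ are terms of type $\tau$; if $x\in\mathcal{V}_\tau$ and $t$ has type $\sigma$, then $\lambda x.t$ has type $\tau\to\sigma$; if $t$ has type $\tau\to\sigma$ and $u$ has type $\tau$, then $t\,u$ has type $\sigma$. Terms are taken up to renaming of bound variables; $t[x\leftarrow u]$ is capture-avoiding substitution; $\equiv_\beta$ is the congruence generated by $(\lambda x.t)u \hookrightarrow t[x\leftarrow u]$ (no $\eta$). Formulas are terms of type $o$. The constants include $\top,\bot$ of type $o$; $\neg$ of type $o\to o$; $\Rightarrow,\wedge,\vee$ of type $o\to o\to o$; and for every type $\tau$, $\forall_\tau,\exists_\tau$ of type $(\tau\to o)\to o$ and $=_\tau$ of type $\tau\to\tau\to o$ (written infix); there may be further constants. $\forall x.A$ and $\exists x.A$ abbreviate $\forall_\tau(\lambda x.A)$, $\exists_\tau(\lambda x.A)$. $FV$ denotes free variables. A context is a finite sequence of formulas. Derivability. Intuitionistic logic has the usual natural deduction rules: introduction and elimination for $\Rightarrow,\wedge,\vee$; Not-I: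 from $\Gamma,A\vdash\bot$ infer $\Gamma\vdash\neg A$; Not-E: from $\Gamma\vdash\neg A$ and $\Gamma\vdash A$ infer $\Gamma\vdash\bot$; Bot-E: from $\Gamma\vdash\bot$ infer $\Gamma\vdash A$; Top-I: $\Gamma\vdash\top$; All-I: from $\Gamma\vdash P\,x$ with $x\notin FV(\Gamma,P)$ infer $\Gamma\vdash\forall P$; All-E: from $\Gamma\vdash\forall P$ infer $\Gamma\vdash P\,t$; Ex-I: from $\Gamma\vdash P\,t$ infer $\Gamma\vdash\exists P$; Ex-E: from $\Gamma\vdash\exists P$ and $\Gamma,P\,x\vdash A$ with $x\notin FV(\Gamma,P,A)$ infer $\Gamma\vdash A$; Ax: $\Gamma,A,\Delta\vdash A$; Conv: from $\Gamma\vdash A$ and $A\equiv_\beta B$ infer $\Gamma\vdash B$. Classical logic adds PEM: $\Gamma\vdash A\vee\neg A$. $\Gamma\vdash_i A$ and $\Gamma\vdash_c A$ denote intuitionistic and classical derivability (no rules for equality, no extensionality). Kuroda's translation. For a term $t$, $t_{Ku}$ is defined by: $x_{Ku}:=x$ for variables; $(\forall_\tau)_{Ku}:=\lambda p.\forall_\tau(\lambda x.\neg\neg(p\,x))$ for each type $\tau$; $c_{Ku}:=c$ for every other constant; $(\lambda x.t)_{Ku}:=\lambda x.t_{Ku}$; $(t\,u)_{Ku}:=t_{Ku}\,u_{Ku}$. For a formula $A$, $A^{Ku}:=\neg\neg A_{Ku}$. For a context $\Gamma=A_1,\dots,A_n$, $\Gamma_{Ku}:=(A_1)_{Ku},\dots,(A_n)_{Ku}$.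 The reverse translation property is the statement that for every context $\Gamma$ and formula $A$, if $\Gamma_{Ku}\vdash_i A^{Ku}$ then $\Gamma\vdash_c A$. -}

module Defs where

open import Data.List using (List; []; _∷_; _++_; map; concatMap)
open import Data.List.Membership.Propositional using (_∈_; _∉_)
open import Data.List.Relation.Unary.Any using (here; there)
open import Data.Nat using (ℕ)
open import Data.Product using (_×_; _,_)
open import Relation.Binary.PropositionalEquality using (refl)

infixr 7 _⇒_

data Ty : Set where
  ι o : Ty
  _⇒_ : Ty → Ty → Ty

-- The variables of type τ are the pairs (τ , n) with n : ℕ, so there are
-- infinitely many of each type.
Var : Set
Var = Ty × ℕ

-- A signature gives, for each type, the constants other than the logical ones.
Signature : Set₁
Signature = Ty → Set

module HOL (Sig : Signature) where

  infixl 9 _·_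
  infix  8 `¬_
  infixr 7 _`∧_
  infixr 6 _`∨_
  infixr 5 _`⇒_
  infix  4 _≡β_ _⊢⟨_⟩_ _⊢ᵢ_ _⊢c_

  data Const : Ty → Set where
    `⊤ᶜ `⊥ᶜ     : Const o
    `¬ᶜ         : Const (o ⇒ o)
    `⇒ᶜ `∧ᶜ `∨ᶜ : Const (o ⇒ o ⇒ o)
    `∀ᶜ `∃ᶜ     : (τ : Ty) → Const ((τ ⇒ o) ⇒ o)
    `=ᶜ         : (τ : Ty) → Const (τ ⇒ τ ⇒ o)
    extra       : ∀ {τ} → Sig τ → Const τ

  -- Locally nameless terms: free variables are named, bound variables are
  -- typed de Bruijn indices into Δ.  Thus Term [] τ is the set of terms of
  -- type τ up to renaming of bound variables, and there is a term of every
  -- type (a free variable) in every Δ.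
  data Term (Δ : List Ty) : Ty → Set where
    var  : ∀ {τ} → ℕ → Term Δ τ
    bvar : ∀ {τ} → τ ∈ Δ → Term Δ τ
    con  : ∀ {τ} → Const τ → Term Δ τ
    ƛ    : ∀ {τ σ} → Term (τ ∷ Δ) σ → Term Δ (τ ⇒ σ)
    _·_  : ∀ {τ σ} → Term Δ (τ ⇒ σ) → Term Δ τ → Term Δ σ

  Formula : Set
  Formula = Term [] o

  -- The most recent hypothesis is at the head: Γ , A is A ∷ Γ.
  Context : Set
  Context = List Formula

  FV : ∀ {Δ τ} → Term Δ τ → List Var
  FV {τ = τ} (var n) = (τ , n) ∷ []
  FV (bvar i)        = []
  FV (con c)         = []
  FV (ƛ t)           = FV t
  FV (t · u)         = FV t ++ FV u

  FVᶜ : Context → List Var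
  FVᶜ = concatMap FV

  Ren : List Ty → List Ty → Set
  Ren Δ Δ′ = ∀ {τ} → τ ∈ Δ → τ ∈ Δ′

  Sub : List Ty → List Ty → Set
  Sub Δ Δ′ = ∀ {τ} → τ ∈ Δ → Term Δ′ τ

  liftRen : ∀ {Δ Δ′ σ} → Ren Δ Δ′ → Ren (σ ∷ Δ) (σ ∷ Δ′)
  liftRen ρ (here e)  = here e
  liftRen ρ (there i) = there (ρ i)

  rename : ∀ {Δ Δ′ τ} → Ren Δ Δ′ → Term Δ τ → Term Δ′ τ
  rename ρ (var n)  = var n
  rename ρ (bvar i) = bvar (ρ i)
  rename ρ (con c)  = con c
  rename ρ (ƛ t)    = ƛ (rename (liftRen ρ) t)
  rename ρ (t · u)  = rename ρ t · rename ρ u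

  liftSub : ∀ {Δ Δ′ σ} → Sub Δ Δ′ → Sub (σ ∷ Δ) (σ ∷ Δ′)
  liftSub s (here e)  = bvar (here e)
  liftSub s (there i) = rename there (s i)

  subst : ∀ {Δ Δ′ τ} → Sub Δ Δ′ → Term Δ τ → Term Δ′ τ
  subst s (var n)  = var n
  subst s (bvar i) = s i
  subst s (con c)  = con c
  subst s (ƛ t)    = ƛ (subst (liftSub s) t)
  subst s (t · u)  = subst s t · subst s u

  single : ∀ {Δ σ} → Term Δ σ → Sub (σ ∷ Δ) Δ
  single u (here refl) = u
  single u (there i)   = bvar i

  _[_] : ∀ {Δ σ τ} → Term (σ ∷ Δ) τ → Term Δ σ → Term Δ τ
  t [ u ] = subst (single u) t

  data _≡β_ {Δ : List Ty} : ∀ {τ} → Term Δ τ → Term Δ τ → Set where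
    β      : ∀ {τ σ} (t : Term (τ ∷ Δ) σ) (u : Term Δ τ) → ƛ t · u ≡β t [ u ]
    ƛ-cong : ∀ {τ σ} {t t′ : Term (τ ∷ Δ) σ} → t ≡β t′ → ƛ t ≡β ƛ t′
    ·-cong : ∀ {τ σ} {t t′ : Term Δ (τ ⇒ σ)} {u u′ : Term Δ τ} →
             t ≡β t′ → u ≡β u′ → t · u ≡β t′ · u′
    reflβ  : ∀ {τ} {t : Term Δ τ} → t ≡β t
    symβ   : ∀ {τ} {t u : Term Δ τ} → t ≡β u → u ≡β t
    transβ : ∀ {τ} {t u v : Term Δ τ} → t ≡β u → u ≡β v → t ≡β v

  `⊤ `⊥ : ∀ {Δ} → Term Δ o
  `⊤ = con `⊤ᶜ
  `⊥ = con `⊥ᶜ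

  `¬_ : ∀ {Δ} → Term Δ o → Term Δ o
  `¬ A = con `¬ᶜ · A

  _`⇒_ _`∧_ _`∨_ : ∀ {Δ} → Term Δ o → Term Δ o → Term Δ o
  A `⇒ B = con `⇒ᶜ · A · B
  A `∧ B = con `∧ᶜ · A · B
  A `∨ B = con `∨ᶜ · A · B

  `∀ `∃ : ∀ {Δ τ} → Term Δ (τ ⇒ o) → Term Δ o
  `∀ {τ = τ} P = con (`∀ᶜ τ) · P
  `∃ {τ = τ} P = con (`∃ᶜ τ) · P

  data Logic : Set where
    intuitionistic classical : Logic

  data _⊢⟨_⟩_ (Γ : Context) : Logic → Formula → Set where
    ax   : ∀ {L A} → A ∈ Γ → Γ ⊢⟨ L ⟩ A
    conv : ∀ {L A B} → Γ ⊢⟨ L ⟩ A → A ≡β B → Γ ⊢⟨ L ⟩ B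
    ⊤I   : ∀ {L} → Γ ⊢⟨ L ⟩ `⊤
    ⊥E   : ∀ {L A} → Γ ⊢⟨ L ⟩ `⊥ → Γ ⊢⟨ L ⟩ A
    ¬I   : ∀ {L A} → A ∷ Γ ⊢⟨ L ⟩ `⊥ → Γ ⊢⟨ L ⟩ `¬ A
    ¬E   : ∀ {L A} → Γ ⊢⟨ L ⟩ `¬ A → Γ ⊢⟨ L ⟩ A → Γ ⊢⟨ L ⟩ `⊥
    ⇒I   : ∀ {L A B} → A ∷ Γ ⊢⟨ L ⟩ B → Γ ⊢⟨ L ⟩ A `⇒ B
    ⇒E   : ∀ {L A B} → Γ ⊢⟨ L ⟩ A `⇒ B → Γ ⊢⟨ L ⟩ A → Γ ⊢⟨ L ⟩ B
    ∧I   : ∀ {L A B} → Γ ⊢⟨ L ⟩ A → Γ ⊢⟨ L ⟩ B → Γ ⊢⟨ L ⟩ A `∧ B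
    ∧E₁  : ∀ {L A B} → Γ ⊢⟨ L ⟩ A `∧ B → Γ ⊢⟨ L ⟩ A
    ∧E₂  : ∀ {L A B} → Γ ⊢⟨ L ⟩ A `∧ B → Γ ⊢⟨ L ⟩ B
    ∨I₁  : ∀ {L A B} → Γ ⊢⟨ L ⟩ A → Γ ⊢⟨ L ⟩ A `∨ B
    ∨I₂  : ∀ {L A B} → Γ ⊢⟨ L ⟩ B → Γ ⊢⟨ L ⟩ A `∨ B
    ∨E   : ∀ {L A B C} → Γ ⊢⟨ L ⟩ A `∨ B → A ∷ Γ ⊢⟨ L ⟩ C → B ∷ Γ ⊢⟨ L ⟩ C →
           Γ ⊢⟨ L ⟩ C
    ∀I   : ∀ {L τ} {P : Term [] (τ ⇒ o)} (x : ℕ) → (τ , x) ∉ FVᶜ Γ ++ FV P →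
           Γ ⊢⟨ L ⟩ P · var x → Γ ⊢⟨ L ⟩ `∀ P
    ∀E   : ∀ {L τ} {P : Term [] (τ ⇒ o)} → Γ ⊢⟨ L ⟩ `∀ P → (t : Term [] τ) →
           Γ ⊢⟨ L ⟩ P · t
    ∃I   : ∀ {L τ} {P : Term [] (τ ⇒ o)} (t : Term [] τ) → Γ ⊢⟨ L ⟩ P · t →
           Γ ⊢⟨ L ⟩ `∃ P
    ∃E   : ∀ {L τ} {P : Term [] (τ ⇒ o)} {A} (x : ℕ) →
           (τ , x) ∉ FVᶜ Γ ++ FV P ++ FV A →
           Γ ⊢⟨ L ⟩ `∃ P → (P · var x) ∷ Γ ⊢⟨ L ⟩ A → Γ ⊢⟨ L ⟩ A
    pem  : (A : Formula) → Γ ⊢⟨ classical ⟩ A `∨ `¬ A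

  _⊢ᵢ_ _⊢c_ : Context → Formula → Set
  Γ ⊢ᵢ A = Γ ⊢⟨ intuitionistic ⟩ A
  Γ ⊢c A = Γ ⊢⟨ classical ⟩ A

  kuConst : ∀ {Δ τ} → Const τ → Term Δ τ
  kuConst (`∀ᶜ τ) =
    ƛ (`∀ (ƛ (`¬ `¬ (bvar (there (here refl)) · bvar (here refl)))))
  kuConst c       = con c

  ku : ∀ {Δ τ} → Term Δ τ → Term Δ τ
  ku (var n)  = var n
  ku (bvar i) = bvar i
  ku (con c)  = kuConst c
  ku (ƛ t)    = ƛ (ku t)
  ku (t · u)  = ku t · ku u

  -- A^Ku, as opposed to ku A, which is A_Ku.
  Ku : Formula → Formula
  Ku A = `¬ `¬ ku A

  kuᶜ : Context → Context
  kuᶜ = map ku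

{-# OPTIONS --safe #-}

-- Kuroda's translation inserts ¬¬ under every ∀, also where ∀ occurs as the
-- argument of a predicate on quantifiers; without propositional extensionality
-- such a predicate can detect the insertion.
-- Let Γ be F ∀ and A be ∃C. F (λp. C (λx. ¬¬ p x)), for a variable F.
-- Then Γ_Ku is F (λp. ∀ (λx. ¬¬ p x)), so C := ∀ proves A_Ku = A.
-- Classically A does not follow: take a full finite model with three truth
-- values, one of them false and two true, where ∀ is the minimum and negation
-- never takes the largest value, and let F C mean that C separates the two
-- constant functions with true values.  Then F ∀ holds, but ¬¬ identifies the
-- two true values, so no λp. C (λx. ¬¬ p x) separates them.
module Submission where

open import Defs
open import Data.Empty using (⊥)
open import Data.Fin using (Fin; zero; suc; combine; funToFin; finToFun)
open import Data.Fin.Patterns using (0F; 1F; 2F)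
open import Data.Fin.Properties using (all?; any?; finToFun-funToFin) renaming (_≟_ to _≟ᶠ_)
open import Data.List using (List; []; _∷_; _++_)
open import Data.List.Membership.Propositional using (_∈_; _∉_)
open import Data.List.Membership.Propositional.Properties using (∈-++⁺ˡ; ∈-++⁺ʳ)
open import Data.List.Relation.Unary.All using (All; []; _∷_; lookup)
open import Data.List.Relation.Unary.Any using (here; there)
open import Data.Nat using (ℕ; zero; suc; _^_)
open import Data.Nat.Properties using () renaming (_≟_ to _≟ⁿ_)
open import Data.Product using (Σ; ∃; _×_; _,_; proj₁; proj₂)
open import Data.Product.Properties using (≡-dec)
open import Data.Sum using (_⊎_; inj₁; inj₂)
open import Function using (_∘_; _$_)
open import Relation.Binary.Definitions using (DecidableEquality)
open import Relation.Binary.PropositionalEquality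
  using (_≡_; _≢_; refl; sym; trans; cong; cong₂) renaming (subst to transport)
open import Relation.Nullary using (¬_; Dec; yes; no; contradiction; ¬?; _×-dec_; _⊎-dec_; _→-dec_)
open import Relation.Nullary.Decidable using (map′)
open import Relation.Unary using (Decidable)

-- Decidable equality of types and variables

_≟ᵗ_ : DecidableEquality Ty
ι       ≟ᵗ ι         = yes refl
ι       ≟ᵗ o         = no λ ()
ι       ≟ᵗ (_ ⇒ _)   = no λ ()
o       ≟ᵗ ι         = no λ ()
o       ≟ᵗ o         = yes refl
o       ≟ᵗ (_ ⇒ _)   = no λ ()
(_ ⇒ _) ≟ᵗ ι         = no λ ()
(_ ⇒ _) ≟ᵗ o         = no λ ()
(τ ⇒ σ) ≟ᵗ (τ′ ⇒ σ′) =
  map′ (λ { (refl , refl) → refl }) (λ { refl → refl , refl })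
    ((τ ≟ᵗ τ′) ×-dec (σ ≟ᵗ σ′))

_≟ᵛ_ : DecidableEquality Var
_≟ᵛ_ = ≡-dec _≟ᵗ_ _≟ⁿ_

-- Full finite domains

-- A single individual suffices. Of the three codes at `o`, 0 is false and both 1 and 2 are true.
card : Ty → ℕ
card ι       = 1
card o       = 3
card (τ ⇒ σ) = card σ ^ card τ

-- A function is coded by its table, so pointwise equal functions are
-- propositionally equal without function extensionality.
record D (τ : Ty) : Set where
  constructor ⟨_⟩
  field code : Fin (card τ)
open D

funToFin-cong : ∀ {m n} {f g : Fin m → Fin n} →
                (∀ i → f i ≡ g i) → funToFin f ≡ funToFin g
funToFin-cong {zero}  h = refl
funToFin-cong {suc m} h = cong₂ combine (h zero) (funToFin-cong (h ∘ suc))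

-- Opaque because the type checker must not compute these huge codes.
opaque

  lam : ∀ {τ σ} → (D τ → D σ) → D (τ ⇒ σ)
  lam f = ⟨ funToFin (λ i → code (f ⟨ i ⟩)) ⟩

  app : ∀ {τ σ} → D (τ ⇒ σ) → D τ → D σ
  app f a = ⟨ finToFun (code f) (code a) ⟩

  app-lam : ∀ {τ σ} (f : D τ → D σ) a → app (lam f) a ≡ f a
  app-lam f a = cong ⟨_⟩ (finToFun-funToFin (λ i → code (f ⟨ i ⟩)) (code a))

  lam-cong : ∀ {τ σ} {f g : D τ → D σ} → (∀ a → f a ≡ g a) → lam f ≡ lam g
  lam-cong h = cong ⟨_⟩ (funToFin-cong (λ i → cong code (h ⟨ i ⟩)))

app-lam₂ : ∀ {τ σ υ} (f : D τ → D σ → D υ) a b →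
           app (app (lam (λ x → lam (f x))) a) b ≡ f a b
app-lam₂ f a b = trans (cong (λ g → app g b) (app-lam _ a)) (app-lam (f a) b)

_≟ᵈ_ : ∀ {τ} → DecidableEquality (D τ)
a ≟ᵈ b = map′ (cong ⟨_⟩) (cong code) (code a ≟ᶠ code b)

-- Finiteness of the domains is what lets quantifiers be interpreted by truth values constructively.
allD? : ∀ {τ} {P : D τ → Set} → Decidable P → Dec (∀ a → P a)
allD? P? = map′ (λ h a → h (code a)) (λ h i → h ⟨ i ⟩) (all? (λ i → P? ⟨ i ⟩))

anyD? : ∀ {τ} {P : D τ → Set} → Decidable P → Dec (∃ P)
anyD? P? = map′ (λ (i , p) → ⟨ i ⟩ , p) (λ (a , p) → code a , p) (any? (λ i → P? ⟨ i ⟩))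

default : ∀ τ → D τ
default ι       = ⟨ 0F ⟩
default o       = ⟨ 0F ⟩
default (τ ⇒ σ) = lam (λ _ → default σ)

-- Truth values

Holds : D o → Set
Holds v = v ≢ ⟨ 0F ⟩

holds? : Decidable Holds
holds? v = ¬? (v ≟ᵈ ⟨ 0F ⟩)

-- The value 2 is never taken, so every connective defined through this, negation in particular,
-- merges the two true values.
⌜_⌝ : ∀ {P : Set} → Dec P → D o
⌜ yes _ ⌝ = ⟨ 1F ⟩
⌜ no  _ ⌝ = ⟨ 0F ⟩

⌜⌝⁺ : ∀ {P} (P? : Dec P) → P → Holds ⌜ P? ⌝
⌜⌝⁺ (yes _) _ ()
⌜⌝⁺ (no ¬p) p _ = ¬p p

⌜⌝⁻ : ∀ {P} (P? : Dec P) → Holds ⌜ P? ⌝ → P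
⌜⌝⁻ (yes p) _ = p
⌜⌝⁻ (no _)  h = contradiction refl h

neg : D o → D o
neg a = ⌜ ¬? (holds? a) ⌝

-- The minimum of the values of `p`, which unlike negation can tell 2 from 1.
∀-table : ∀ {τ} → D (τ ⇒ o) → D o
∀-table p with allD? (λ a → app p a ≟ᵈ ⟨ 2F ⟩)
... | yes _ = ⟨ 2F ⟩
... | no  _ = ⌜ allD? (λ a → holds? (app p a)) ⌝

∀-table⁺ : ∀ {τ} (p : D (τ ⇒ o)) → (∀ a → Holds (app p a)) → Holds (∀-table p)
∀-table⁺ p h with allD? (λ a → app p a ≟ᵈ ⟨ 2F ⟩)
... | yes _ = λ ()
... | no  _ = ⌜⌝⁺ (allD? (λ a → holds? (app p a))) h

∀-table⁻ : ∀ {τ} (p : D (τ ⇒ o)) → Holds (∀-table p) → ∀ a → Holds (app p a)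
∀-table⁻ p h a with allD? (λ a → app p a ≟ᵈ ⟨ 2F ⟩)
... | yes e = λ e′ → contradiction (trans (sym (e a)) e′) λ ()
... | no  _ = ⌜⌝⁻ (allD? (λ a → holds? (app p a))) h a

∀-table-2⁺ : ∀ {τ} (p : D (τ ⇒ o)) → (∀ a → app p a ≡ ⟨ 2F ⟩) → ∀-table p ≡ ⟨ 2F ⟩
∀-table-2⁺ p h with allD? (λ a → app p a ≟ᵈ ⟨ 2F ⟩)
... | yes _ = refl
... | no ¬h = contradiction h ¬h

∀-table-2⁻ : ∀ {τ} (p : D (τ ⇒ o)) → ∀-table p ≡ ⟨ 2F ⟩ → ∀ a → app p a ≡ ⟨ 2F ⟩
∀-table-2⁻ p e a with allD? (λ a → app p a ≟ᵈ ⟨ 2F ⟩)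
... | yes h = h a
-- Here the minimum is a value of `⌜_⌝`, hence 1 or 0, and `e` is absurd.
... | no _  with allD? (λ a → holds? (app p a)) | e
...   | yes _ | ()
...   | no _  | ()

-- Evaluation of terms

module Model {Sig : Signature} (I : ∀ {τ} → Sig τ → D τ) where

  open HOL Sig

  Val : Set
  Val = (v : Var) → D (proj₁ v)

  Env : List Ty → Set
  Env Δ = ∀ {τ} → τ ∈ Δ → D τ

  ∅ : Env []
  ∅ ()

  _▹_ : ∀ {Δ σ} → Env Δ → D σ → Env (σ ∷ Δ)
  (η ▹ a) (here refl) = a
  (η ▹ a) (there i)   = η i

  evalᶜ : ∀ {τ} → Const τ → D τ
  evalᶜ `⊤ᶜ     = ⟨ 1F ⟩
  evalᶜ `⊥ᶜ     = ⟨ 0F ⟩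
  evalᶜ `¬ᶜ     = lam neg
  evalᶜ `⇒ᶜ     = lam λ a → lam λ b → ⌜ holds? a →-dec holds? b ⌝
  evalᶜ `∧ᶜ     = lam λ a → lam λ b → ⌜ holds? a ×-dec holds? b ⌝
  evalᶜ `∨ᶜ     = lam λ a → lam λ b → ⌜ holds? a ⊎-dec holds? b ⌝
  evalᶜ (`∀ᶜ τ) = lam ∀-table
  evalᶜ (`∃ᶜ τ) = lam λ p → ⌜ anyD? (λ a → holds? (app p a)) ⌝
  evalᶜ (`=ᶜ τ) = lam λ a → lam λ b → ⌜ a ≟ᵈ b ⌝
  evalᶜ (extra c) = I c

  eval : ∀ {Δ τ} → Val → Env Δ → Term Δ τ → D τ
  eval ρ η (var n)  = ρ (_ , n)
  eval ρ η (bvar i) = η i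
  eval ρ η (con c)  = evalᶜ c
  eval ρ η (ƛ t)    = lam (λ a → eval ρ (η ▹ a) t)
  eval ρ η (t · u)  = app (eval ρ η t) (eval ρ η u)

  eval-rename : ∀ {Δ Δ′ τ} {ρ} {η : Env Δ} {η′ : Env Δ′} (r : Ren Δ Δ′) →
                (∀ {σ} (i : σ ∈ Δ) → η i ≡ η′ (r i)) →
                (t : Term Δ τ) → eval ρ η t ≡ eval ρ η′ (rename r t)
  eval-rename r h (var n)  = refl
  eval-rename r h (bvar i) = h i
  eval-rename r h (con c)  = refl
  eval-rename r h (ƛ t)    = lam-cong λ a →
    eval-rename (liftRen r) (λ { (here refl) → refl ; (there i) → h i }) t
  eval-rename r h (t · u)  = cong₂ app (eval-rename r h t) (eval-rename r h u)

  eval-subst : ∀ {Δ Δ′ τ} {ρ} {η : Env Δ} {η′ : Env Δ′} (s : Sub Δ Δ′) →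
               (∀ {σ} (i : σ ∈ Δ) → η i ≡ eval ρ η′ (s i)) →
               (t : Term Δ τ) → eval ρ η t ≡ eval ρ η′ (subst s t)
  eval-subst s h (var n)  = refl
  eval-subst s h (bvar i) = h i
  eval-subst s h (con c)  = refl
  eval-subst s h (ƛ t)    = lam-cong λ a →
    eval-subst (liftSub s)
      (λ { (here refl) → refl
         ; (there i)   → trans (h i) (eval-rename there (λ _ → refl) (s i)) }) t
  eval-subst s h (t · u)  = cong₂ app (eval-subst s h t) (eval-subst s h u)

  eval-≡β : ∀ {Δ τ} {ρ} {t u : Term Δ τ} → t ≡β u →
            (η : Env Δ) → eval ρ η t ≡ eval ρ η u
  eval-≡β (β t u) η = trans (app-lam _ _)
    (eval-subst (single u) (λ { (here refl) → refl ; (there i) → refl }) t)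
  eval-≡β (ƛ-cong e)   η = lam-cong λ a → eval-≡β e (η ▹ a)
  eval-≡β (·-cong e f) η = cong₂ app (eval-≡β e η) (eval-≡β f η)
  eval-≡β reflβ        η = refl
  eval-≡β (symβ e)     η = sym (eval-≡β e η)
  eval-≡β (transβ e f) η = trans (eval-≡β e η) (eval-≡β f η)

  -- Free variables and updates of valuations

  eval-FV : ∀ {Δ τ} {ρ ρ′ : Val} {η : Env Δ} (t : Term Δ τ) →
            (∀ v → v ∈ FV t → ρ v ≡ ρ′ v) → eval ρ η t ≡ eval ρ′ η t
  eval-FV (var n)  h = h _ (here refl)
  eval-FV (bvar i) h = refl
  eval-FV (con c)  h = refl
  eval-FV (ƛ t)    h = lam-cong λ a → eval-FV t h
  eval-FV (t · u)  h = cong₂ app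
    (eval-FV t (λ v → h v ∘ ∈-++⁺ˡ))
    (eval-FV u (λ v → h v ∘ ∈-++⁺ʳ (FV t)))

  _[_↦_] : Val → (v : Var) → D (proj₁ v) → Val
  (ρ [ v ↦ a ]) w with v ≟ᵛ w
  ... | yes refl = a
  ... | no _     = ρ w

  update-≡ : ∀ ρ v a → (ρ [ v ↦ a ]) v ≡ a
  update-≡ ρ v a with v ≟ᵛ v
  ... | yes refl = refl
  ... | no v≢v   = contradiction refl v≢v

  update-≢ : ∀ ρ v a w → v ≢ w → ρ w ≡ (ρ [ v ↦ a ]) w
  update-≢ ρ v a w v≢w with v ≟ᵛ w
  ... | yes v≡w = contradiction v≡w v≢w
  ... | no _    = refl

  eval-fresh : ∀ {Δ τ} {ρ} {η : Env Δ} (t : Term Δ τ) v a →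
               v ∉ FV t → eval ρ η t ≡ eval (ρ [ v ↦ a ]) η t
  eval-fresh t v a v∉t = eval-FV t λ w w∈t →
    update-≢ _ v a w λ { refl → v∉t w∈t }

  -- Truth in the model and soundness

  infix 4 _⊨_ _⊨*_

  _⊨_ : Val → Formula → Set
  ρ ⊨ A = Holds (eval ρ ∅ A)

  _⊨*_ : Val → Context → Set
  ρ ⊨* Γ = All (ρ ⊨_) Γ

  ⊨*-fresh : ∀ {ρ} Γ v a → v ∉ FVᶜ Γ → ρ ⊨* Γ → (ρ [ v ↦ a ]) ⊨* Γ
  ⊨*-fresh []      v a v∉ []       = []
  ⊨*-fresh (A ∷ Γ) v a v∉ (hA ∷ hΓ) =
    transport Holds (eval-fresh A v a (v∉ ∘ ∈-++⁺ˡ)) hA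
    ∷ ⊨*-fresh Γ v a (v∉ ∘ ∈-++⁺ʳ (FV A)) hΓ

  ⊨-instance : ∀ {τ ρ} (P : Term [] (τ ⇒ o)) x a → (τ , x) ∉ FV P →
               eval (ρ [ (τ , x) ↦ a ]) ∅ (P · var x) ≡ app (eval ρ ∅ P) a
  ⊨-instance {ρ = ρ} P x a x∉ =
    cong₂ app (sym (eval-fresh P _ a x∉)) (update-≡ ρ _ a)

  -- The equation is a parameter because `app` and `lam` are opaque: each connective reaches its
  -- truth value only through `app-lam`.
  ⌜⌝⇔ : ∀ {v P} (P? : Dec P) → v ≡ ⌜ P? ⌝ → (P → Holds v) × (Holds v → P)
  ⌜⌝⇔ P? refl = ⌜⌝⁺ P? , ⌜⌝⁻ P?

  module _ (ρ : Val) where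

    private
      ⟦_⟧ : ∀ {τ} → Term [] τ → D τ
      ⟦_⟧ = eval ρ ∅

    ⊨¬ : ∀ A → (¬ ρ ⊨ A → ρ ⊨ `¬ A) × (ρ ⊨ `¬ A → ¬ ρ ⊨ A)
    ⊨¬ A = ⌜⌝⇔ (¬? (holds? ⟦ A ⟧)) (app-lam _ _)

    ⊨⇒ : ∀ A B → ((ρ ⊨ A → ρ ⊨ B) → ρ ⊨ A `⇒ B) × (ρ ⊨ A `⇒ B → ρ ⊨ A → ρ ⊨ B)
    ⊨⇒ A B = ⌜⌝⇔ (holds? ⟦ A ⟧ →-dec holds? ⟦ B ⟧) (app-lam₂ _ _ _)

    ⊨∧ : ∀ A B → (ρ ⊨ A × ρ ⊨ B → ρ ⊨ A `∧ B) × (ρ ⊨ A `∧ B → ρ ⊨ A × ρ ⊨ B)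
    ⊨∧ A B = ⌜⌝⇔ (holds? ⟦ A ⟧ ×-dec holds? ⟦ B ⟧) (app-lam₂ _ _ _)

    ⊨∨ : ∀ A B → (ρ ⊨ A ⊎ ρ ⊨ B → ρ ⊨ A `∨ B) × (ρ ⊨ A `∨ B → ρ ⊨ A ⊎ ρ ⊨ B)
    ⊨∨ A B = ⌜⌝⇔ (holds? ⟦ A ⟧ ⊎-dec holds? ⟦ B ⟧) (app-lam₂ _ _ _)

    ⊨∃ : ∀ {τ} (P : Term [] (τ ⇒ o)) →
         ((∃ λ a → Holds (app ⟦ P ⟧ a)) → ρ ⊨ `∃ P) ×
         (ρ ⊨ `∃ P → ∃ λ a → Holds (app ⟦ P ⟧ a))
    ⊨∃ P = ⌜⌝⇔ (anyD? (λ a → holds? (app ⟦ P ⟧ a))) (app-lam _ _)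

    ⊨∀⁺ : ∀ {τ} (P : Term [] (τ ⇒ o)) → (∀ a → Holds (app ⟦ P ⟧ a)) → ρ ⊨ `∀ P
    ⊨∀⁺ P h = transport Holds (sym (app-lam ∀-table _)) (∀-table⁺ ⟦ P ⟧ h)

    ⊨∀⁻ : ∀ {τ} (P : Term [] (τ ⇒ o)) → ρ ⊨ `∀ P → ∀ a → Holds (app ⟦ P ⟧ a)
    ⊨∀⁻ P h = ∀-table⁻ ⟦ P ⟧ (transport Holds (app-lam ∀-table _) h)

  -- The valuation varies in the induction, since the eigenvariable rules update it at the fresh
  -- variable.
  sound : ∀ {L Γ A} → Γ ⊢⟨ L ⟩ A → ∀ ρ → ρ ⊨* Γ → ρ ⊨ A
  sound (ax i) ρ h = lookup h i
  sound (conv d e) ρ h = transport Holds (eval-≡β e ∅) (sound d ρ h)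
  sound ⊤I ρ h ()
  sound (⊥E d) ρ h = contradiction refl (sound d ρ h)
  sound (¬I {A = A} d) ρ h = proj₁ (⊨¬ ρ A) λ a → sound d ρ (a ∷ h) refl
  sound (¬E {A = A} d e) ρ h = contradiction (sound e ρ h) (proj₂ (⊨¬ ρ A) (sound d ρ h))
  sound (⇒I {A = A} {B} d) ρ h = proj₁ (⊨⇒ ρ A B) λ a → sound d ρ (a ∷ h)
  sound (⇒E {A = A} {B} d e) ρ h = proj₂ (⊨⇒ ρ A B) (sound d ρ h) (sound e ρ h)
  sound (∧I {A = A} {B} d e) ρ h = proj₁ (⊨∧ ρ A B) (sound d ρ h , sound e ρ h)
  sound (∧E₁ {A = A} {B} d) ρ h = proj₁ (proj₂ (⊨∧ ρ A B) (sound d ρ h))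
  sound (∧E₂ {A = A} {B} d) ρ h = proj₂ (proj₂ (⊨∧ ρ A B) (sound d ρ h))
  sound (∨I₁ {A = A} {B} d) ρ h = proj₁ (⊨∨ ρ A B) (inj₁ (sound d ρ h))
  sound (∨I₂ {A = A} {B} d) ρ h = proj₁ (⊨∨ ρ A B) (inj₂ (sound d ρ h))
  sound (∨E {A = A} {B} d e f) ρ h with proj₂ (⊨∨ ρ A B) (sound d ρ h)
  ... | inj₁ a = sound e ρ (a ∷ h)
  ... | inj₂ b = sound f ρ (b ∷ h)
  sound {Γ = Γ} (∀I {P = P} x x∉ d) ρ h = ⊨∀⁺ ρ P λ a →
    transport Holds (⊨-instance P x a (x∉ ∘ ∈-++⁺ʳ (FVᶜ Γ)))
      (sound d _ (⊨*-fresh Γ _ a (x∉ ∘ ∈-++⁺ˡ) h))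
  sound (∀E {P = P} d t) ρ h = ⊨∀⁻ ρ P (sound d ρ h) (eval ρ ∅ t)
  sound (∃I {P = P} t d) ρ h = proj₁ (⊨∃ ρ P) (eval ρ ∅ t , sound d ρ h)
  sound {Γ = Γ} (∃E {P = P} {A} x x∉ d e) ρ h with proj₂ (⊨∃ ρ P) (sound d ρ h)
  ... | a , pa =
    transport Holds (sym (eval-fresh A _ a (x∉ ∘ ∈-++⁺ʳ (FVᶜ Γ) ∘ ∈-++⁺ʳ (FV P))))
      (sound e _
        (transport Holds (sym (⊨-instance P x a (x∉ ∘ ∈-++⁺ʳ (FVᶜ Γ) ∘ ∈-++⁺ˡ))) pa
         ∷ ⊨*-fresh Γ _ a (x∉ ∘ ∈-++⁺ˡ) h))
  -- Excluded middle is valid because `Holds` is decidable.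
  sound (pem A) ρ h with holds? (eval ρ ∅ A)
  ... | yes a = proj₁ (⊨∨ ρ A (`¬ A)) (inj₁ a)
  ... | no ¬a = proj₁ (⊨∨ ρ A (`¬ A)) (inj₂ (proj₁ (⊨¬ ρ A) ¬a))

-- The counterexample

NoConstants : Signature
NoConstants _ = ⊥

module Counterexample where

  open HOL NoConstants
  open Model {NoConstants} (λ ())

  F : ∀ {Δ} → Term Δ (((ι ⇒ o) ⇒ o) ⇒ o)
  F = var 0

  F∀ : Formula
  F∀ = F · con (`∀ᶜ ι)

  ¬¬px : ∀ {Δ} → Term (ι ∷ (ι ⇒ o) ∷ Δ) o
  ¬¬px = `¬ `¬ (bvar (there (here refl)) · bvar (here refl))

  -- The quantifier C is the one index left open, to be bound by the `∃` or given a value.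
  λpC¬¬ : Term (((ι ⇒ o) ⇒ o) ∷ []) ((ι ⇒ o) ⇒ o)
  λpC¬¬ = ƛ (bvar (there (here refl)) · ƛ ¬¬px)

  ∃F¬¬ : Formula
  ∃F¬¬ = `∃ (ƛ (F · λpC¬¬))

  ku-derivation : kuᶜ (F∀ ∷ []) ⊢ᵢ Ku ∃F¬¬
  ku-derivation = ¬I $ ¬E (ax (here refl)) $
    -- With this witness, one β-step turns the body into exactly the translated hypothesis.
    ∃I (con (`∀ᶜ ι)) (conv (ax (there (here refl))) (symβ (β _ _)))

  const : D o → D (ι ⇒ o)
  const v = lam λ _ → v

  separates? : (C : D ((ι ⇒ o) ⇒ o)) → Dec (app C (const ⟨ 2F ⟩) ≢ app C (const ⟨ 1F ⟩))
  separates? C = ¬? (app C (const ⟨ 2F ⟩) ≟ᵈ app C (const ⟨ 1F ⟩))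

  ρ₀ : Val
  ρ₀ = (default ∘ proj₁) [ (((ι ⇒ o) ⇒ o) ⇒ o , 0) ↦ lam (⌜_⌝ ∘ separates?) ]

  ρ₀-F : ∀ C → app (ρ₀ (_ , 0)) C ≡ ⌜ separates? C ⌝
  ρ₀-F C = trans
    (cong (λ f → app f C) (update-≡ (default ∘ proj₁) (_ , 0) _)) (app-lam _ C)

  -- The minimum of the constant function 2 is 2. If the constant function 1 had the same minimum,
  -- its value at the sole individual would be 2.
  ⊨F∀ : ρ₀ ⊨ F∀
  ⊨F∀ = proj₁ (⌜⌝⇔ (separates? _) (ρ₀-F _)) λ e →
    contradiction (trans (sym (app-lam _ ⟨ 0F ⟩)) (∀-table-2⁻ (const ⟨ 1F ⟩) (∀-1≡2 e) ⟨ 0F ⟩)) λ ()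
    where
    ∀-1≡2 : app (lam ∀-table) (const ⟨ 2F ⟩) ≡ app (lam ∀-table) (const ⟨ 1F ⟩) →
            ∀-table (const ⟨ 1F ⟩) ≡ ⟨ 2F ⟩
    ∀-1≡2 e = trans (sym (app-lam ∀-table _)) (trans (sym e)
      (trans (app-lam ∀-table _) (∀-table-2⁺ (const ⟨ 2F ⟩) (app-lam _))))

  eval-¬¬px-const : ∀ {Δ} (η : Env Δ) v x →
                    eval ρ₀ ((η ▹ const v) ▹ x) ¬¬px ≡ neg (neg v)
  eval-¬¬px-const η v x = trans (app-lam neg _) (cong neg
    (trans (app-lam neg _) (cong neg (app-lam (λ _ → v) x))))

  -- neg (neg ⟨ 2F ⟩) and neg (neg ⟨ 1F ⟩) are both ⟨ 1F ⟩.
  ⊭∃F¬¬ : ¬ ρ₀ ⊨ ∃F¬¬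
  ⊭∃F¬¬ h with proj₂ (⊨∃ ρ₀ (ƛ (F · λpC¬¬))) h
  ... | C , hC =
    proj₂ (⌜⌝⇔ (separates? C¬¬) C¬¬-F) hC
      (trans (C¬¬-const ⟨ 2F ⟩) (sym (C¬¬-const ⟨ 1F ⟩)))
    where
    C¬¬ : D ((ι ⇒ o) ⇒ o)
    C¬¬ = eval ρ₀ (∅ ▹ C) λpC¬¬
    C¬¬-F : app (eval ρ₀ ∅ (ƛ (F · λpC¬¬))) C ≡ ⌜ separates? C¬¬ ⌝
    C¬¬-F = trans (app-lam (λ a → eval ρ₀ (∅ ▹ a) (F · λpC¬¬)) C) (ρ₀-F C¬¬)
    C¬¬-const : ∀ v → app C¬¬ (const v) ≡ app C (const (neg (neg v)))
    C¬¬-const v = trans (app-lam _ (const v))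
      -- Pointwise equality gives equality of codes, so even an arbitrary `C` returns the same value
      -- on both functions.
      (cong (app C) (lam-cong (eval-¬¬px-const (∅ ▹ C) v)))

mainTheorem7 : Σ Signature λ Sig → let open HOL Sig in
    Σ Context λ Γ → Σ Formula λ A →
    (kuᶜ Γ ⊢ᵢ Ku A) × (¬ (Γ ⊢c A))
mainTheorem7 = NoConstants , F∀ ∷ [] , ∃F¬¬ , ku-derivation ,
  λ d → ⊭∃F¬¬ (sound d ρ₀ (⊨F∀ ∷ []))
  where
  open Counterexample
  open Model {NoConstants} (λ ())
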